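{- Let $n\in\mathbb{N}$ and let $G$ be the graph with vertex set $\{r_0,r_1,\dots,r_n\}\,\dot\cup\,\{w_1,\dots,w_{n-1}\}$ (all listed vertices distinct) whose edges are exactly: $r_ir_{i+1}$ for all $0\le i<n$; $w_iw_{i+1}$ for all $1\le i<n-1$; and $w_ir_{i+1}$ and $w_ir_{i-1}$ for all $1\le i\le n-1$. Then the set $\{r_0,r_1,\dots,r_n\}$ is agile in $G$, but $G$ does not contain $K_{2,5}$ as a minor.
   Context: Graphs are simple and undirected. A pair $(X_1,X_2)$ of disjoint vertex sets of a graph $G$ is independent if there are two disjoint trees $T_1,T_2$ in $G$ such that $X_1\subseteq V(T_1)$ and $X_2\subseteq V(T_2)$ (partition classes may be empty, and if $X_i=\emptyset$ the corresponding $T_i$ may be taken empty). A set $X\subseteq V(G)$ is agile (in $G$) if for every partition $X=X_1\,\dot\cup\,X_2$ the pair $(X_1,X_2)$ is independent. -}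

module Defs where

open import Level using (0ℓ)
import Data.Empty
open import Data.Unit using (⊤)
open import Data.Nat.Base using (ℕ; suc; _∸_; _≤_)
open import Data.Nat.Properties using (1+n≢n)
open import Data.Fin.Base using (Fin; toℕ)
open import Data.List.Base using (List; _∷_; _∷ʳ_; length)
open import Data.List.Relation.Unary.Linked using (Linked)
open import Data.List.Relation.Unary.Unique.Propositional using (Unique)
open import Data.Product using (Σ-syntax; ∃-syntax; _×_; _,_)
open import Data.Sum using (_⊎_; inj₁; inj₂)
open import Relation.Binary.Core using (Rel)
open import Relation.Binary.Definitions using (Symmetric; Irreflexive)
open import Relation.Binary.Construct.Closure.ReflexiveTransitive using (Star)
open import Relation.Binary.Construct.Closure.Symmetric
  using (SymClosure; fwd; bwd; symmetric)
open import Relation.Binary.PropositionalEquality using (_≡_; _≢_; refl; sym)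
open import Relation.Nullary using (¬_)
open import Relation.Unary
  using (Pred; _∈_; _⊆_; _∪_; _≐_; _⊥_; Empty; Satisfiable)

record Graph : Set₁ where
  field
    V          : Set
    Adj        : Rel V 0ℓ
    Adj-sym    : Symmetric Adj
    Adj-irrefl : Irreflexive _≡_ Adj

open Graph public

record Subgraph (G : Graph) : Set₁ where
  field
    verts     : Pred (V G) 0ℓ
    edges     : Rel (V G) 0ℓ
    edges-sym : Symmetric edges
    edges-Adj : ∀ {u v} → edges u v → Adj G u v
    edges-end : ∀ {u v} → edges u v → u ∈ verts × v ∈ verts

open Subgraph public

induced : (G : Graph) → Pred (V G) 0ℓ → Subgraph G
induced G X = record
  { verts     = X
  ; edges     = λ u v → u ∈ X × v ∈ X × Adj G u v
  ; edges-sym = λ (p , q , e) → q , p , Adj-sym G e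
  ; edges-Adj = λ (_ , _ , e) → e
  ; edges-end = λ (p , q , _) → p , q
  }

module _ {G : Graph} where

  Connected : Subgraph G → Set
  Connected H = Satisfiable (verts H) ×
    (∀ {u v} → u ∈ verts H → v ∈ verts H → Star (edges H) u v)

  -- The list x ∷ xs enumerates the distinct vertices of a cycle, in order; the
  -- final ∷ʳ x contributes the closing edge.
  IsCycle : Subgraph G → V G → List (V G) → Set
  IsCycle H x xs =
    2 ≤ length xs × Unique (x ∷ xs) × Linked (edges H) (x ∷ xs ∷ʳ x)

  Acyclic : Subgraph G → Set
  Acyclic H = ∀ x xs → ¬ IsCycle H x xs

  IsTree : Subgraph G → Set
  IsTree H = Connected H × Acyclic H

  -- Trees are nonempty, except that an empty X may be covered by the empty
  -- subgraph.
  TreeCovering : Pred (V G) 0ℓ → Subgraph G → Set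
  TreeCovering X T =
    X ⊆ verts T × (IsTree T ⊎ (Empty X × Empty (verts T)))

Independent : (G : Graph) → Pred (V G) 0ℓ → Pred (V G) 0ℓ → Set₁
Independent G X₁ X₂ =
  Σ[ T₁ ∈ Subgraph G ] Σ[ T₂ ∈ Subgraph G ]
    verts T₁ ⊥ verts T₂ × TreeCovering X₁ T₁ × TreeCovering X₂ T₂

Agile : (G : Graph) → Pred (V G) 0ℓ → Set₁
Agile G X = ∀ (X₁ X₂ : Pred (V G) 0ℓ) →
  X₁ ∪ X₂ ≐ X → X₁ ⊥ X₂ → Independent G X₁ X₂

-- A minor model of H in G: disjoint connected branch sets, one for each vertex
-- of H, joined by an edge of G whenever the vertices of H are adjacent.
record MinorModel (H G : Graph) : Set₁ where
  field
    branch           : V H → Pred (V G) 0ℓ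
    branch-connected : ∀ x → Connected (induced G (branch x))
    branch-disjoint  : ∀ {x y} → x ≢ y → branch x ⊥ branch y
    branch-adjacent  : ∀ {x y} → Adj H x y →
      ∃[ u ] ∃[ v ] (u ∈ branch x × v ∈ branch y × Adj G u v)

infix 4 _IsMinorOf_

_IsMinorOf_ : Graph → Graph → Set₁
H IsMinorOf G = MinorModel H G

K : ℕ → ℕ → Graph
K m n = record
  { V          = Fin m ⊎ Fin n
  ; Adj        = adj
  ; Adj-sym    = λ {x} {y} → adj-sym x y
  ; Adj-irrefl = λ { {inj₁ _} refl () ; {inj₂ _} refl () }
  }
  where
  adj : Rel (Fin m ⊎ Fin n) 0ℓ
  adj (inj₁ _) (inj₁ _) = Data.Empty.⊥
  adj (inj₁ _) (inj₂ _) = ⊤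
  adj (inj₂ _) (inj₁ _) = ⊤
  adj (inj₂ _) (inj₂ _) = Data.Empty.⊥

  adj-sym : ∀ x y → adj x y → adj y x
  adj-sym (inj₁ _) (inj₂ _) e = e
  adj-sym (inj₂ _) (inj₁ _) e = e

-- r i is r_(toℕ i), for 0 ≤ toℕ i ≤ n, whereas w i is w_(1 + toℕ i), so that
-- the indices of the w's run from 1 to n - 1 (there are none if n ≤ 1).
data Vertex (n : ℕ) : Set where
  r : Fin (suc n) → Vertex n
  w : Fin (n ∸ 1) → Vertex n

windex : ∀ {n} → Fin (n ∸ 1) → ℕ
windex i = suc (toℕ i)

data Edge (n : ℕ) : Rel (Vertex n) 0ℓ where
  r-r   : ∀ {i j} → toℕ j ≡ suc (toℕ i) → Edge n (r i) (r j)
  w-w   : ∀ {i j} → windex {n} j ≡ suc (windex {n} i) → Edge n (w i) (w j)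
  w-r⁺  : ∀ {i j} → toℕ j ≡ suc (windex {n} i) → Edge n (w i) (r j)
  w-r⁻  : ∀ {i j} → suc (toℕ j) ≡ windex {n} i → Edge n (w i) (r j)

theGraph : ℕ → Graph
theGraph n = record
  { V          = Vertex n
  ; Adj        = SymClosure (Edge n)
  ; Adj-sym    = symmetric (Edge n)
  ; Adj-irrefl = λ { refl (fwd e) → loopless e ; refl (bwd e) → loopless e }
  }
  where
  loopless : ∀ {v} → ¬ Edge n v v
  loopless (r-r p) = 1+n≢n (sym p)
  loopless (w-w p) = 1+n≢n (sym p)

data IsR {n : ℕ} : Pred (Vertex n) 0ℓ where
  isR : ∀ i → IsR (r i)

-- Put r_i and w_i in column i.  Vertices are adjacent exactly when their columns
-- are consecutive, and every column strictly between 0 and n consists of two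
-- vertices.
--
-- Agility: give w_i the colour opposite to that of r_i.  Each colour class then
-- has at most one vertex in every column and exactly one in every inner column,
-- so it induces a path.
--
-- Excluding K_{2,5}: a branch set meets an interval of columns, and a column is
-- met by at most two branch sets.  If the hubs A and B both meet some column, let
-- s be the first such column and t the next column that they do not both meet.
-- No other branch set C meets a column in [s, t), so C lies on one side of it,
-- and since C is adjacent to both hubs it meets column s - 1 or t.  If A and B
-- have no common column, say A lies left of B and B starts in column t; then
-- every C meets column t - 1 or t.  Two columns have only four vertices.
module Submission where

open import Defs
open import Level using (0ℓ)
open import Data.Bool.Base using (Bool; true; false; not)
open import Data.Bool.Properties using (not-¬; ¬-not)
  renaming (_≟_ to _≟ᵇ_)
open import Data.Fin.Base using (Fin; zero; suc; toℕ; fromℕ<; inject₁; combine)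
open import Data.Fin.Properties using (toℕ-injective; toℕ<n; toℕ-fromℕ<;
  toℕ-inject₁; any?; pigeonhole; punchOut-injective; combine-injective; <⇒≢)
open import Data.List.Base using ([]; _∷_; _∷ʳ_)
open import Data.List.Relation.Unary.All using (_∷_)
open import Data.List.Relation.Unary.AllPairs using (_∷_)
open import Data.List.Relation.Unary.Linked using (Linked; _∷_)
open import Data.List.Relation.Unary.Unique.Propositional using (Unique)
open import Data.Nat.Base using (ℕ; zero; suc; pred; _+_; _∸_; _≤_; _<_;
  s≤s; s≤s⁻¹)
open import Data.Nat.Induction using (<-rec)
open import Data.Nat.Properties using (suc-injective; +-suc; ∸-monoˡ-≤; m≤n+m;
  m∸n+n≡m; n<1+n; n≤1+n; pred[n]≤n; <⇒≤pred; ≤-refl; ≤-reflexive; ≤-trans;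
  ≤-antisym; ≤-total; <-trans; <-≤-trans; <-irrefl; <-cmp; ≤-<-connex; <⇒≤; ≤⇒≯;
  ≮⇒≥; ≰⇒>; m≤n⇒m<n∨m≡n)
open import Data.Product using (Σ-syntax; ∃; ∃-syntax; _×_; _,_; proj₁; proj₂)
open import Data.Sum using (_⊎_; inj₁; inj₂; [_,_]′)
open import Data.Sum.Properties using (inj₂-injective)
open import Data.Unit using (tt)
open import Function.Base using (_∘_; const; flip)
open import Relation.Binary.Core using (Rel)
open import Relation.Binary.Definitions using (Transitive; tri<; tri≈; tri>)
open import Relation.Binary.Construct.Closure.ReflexiveTransitive
  using (Star; ε; _◅_; reverse)
open import Relation.Binary.Construct.Closure.Symmetric
  using (SymClosure; fwd; bwd; symmetric)
open import Relation.Binary.PropositionalEquality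
  using (_≡_; _≢_; refl; sym; trans; cong; subst)
open import Relation.Nullary using (¬_; yes; no; contradiction)
open import Relation.Unary using (Pred; _∈_; _⊆_; ∅)

-- Natural numbers and consecutive columns.

-- `P` need not be decidable, so the minimum exists only up to double negation. This suffices
-- because every use derives a contradiction.
least : ∀ {p} (P : Pred ℕ p) {k} → P k →
  ¬ ¬ (∃[ m ] P m × (∀ {j} → P j → m ≤ j))
least P {k} pk noLeast = <-rec (λ k → ¬ P k)
  (λ k below pk → noLeast (k , pk , λ pj → ≮⇒≥ (λ j<k → below j<k pj))) k pk

m<n⇒pred[n]<n : ∀ {m n} → m < n → pred n < n
m<n⇒pred[n]<n (s≤s _) = ≤-refl

Next : Rel ℕ 0ℓ
Next i j = j ≡ suc i

Consecutive : Rel ℕ 0ℓ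
Consecutive = SymClosure Next

consecutive⇒≤ : ∀ {i j} → Consecutive i j → j ≤ suc i
consecutive⇒≤ (fwd refl) = ≤-refl
consecutive⇒≤ (bwd refl) = ≤-trans (n≤1+n _) (n≤1+n _)

twin : ∀ {n} → Fin (n ∸ 1) → Fin (suc n)
twin {suc n} i = suc (inject₁ i)

toℕ-twin : ∀ {n} (i : Fin (n ∸ 1)) → toℕ (twin {n} i) ≡ windex {n} i
toℕ-twin {suc n} i = cong suc (toℕ-inject₁ i)

-- The column structure of the graph.

module _ {n : ℕ} where

  private G = theGraph n

  column : Vertex n → ℕ
  column (r i) = toℕ i
  column (w i) = suc (toℕ i)

  adj⇒consecutive : ∀ {u v} → Adj G u v → Consecutive (column u) (column v)
  adj⇒consecutive (fwd e) = edge e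
    where
    edge : ∀ {u v} → Edge n u v → Consecutive (column u) (column v)
    edge (r-r p)  = fwd p
    edge (w-w p)  = fwd p
    edge (w-r⁺ p) = fwd p
    edge (w-r⁻ p) = bwd (sym p)
  adj⇒consecutive (bwd e) = symmetric Next (adj⇒consecutive (fwd e))

  next⇒adj : ∀ u v → Next (column u) (column v) → Adj G u v
  next⇒adj (r i) (r j) p = fwd (r-r p)
  next⇒adj (r i) (w j) p = bwd (w-r⁻ (sym p))
  next⇒adj (w i) (r j) p = fwd (w-r⁺ p)
  next⇒adj (w i) (w j) p = fwd (w-w p)

  column≤n : ∀ v → column v ≤ n
  column≤n (r i) = s≤s⁻¹ (toℕ<n i)
  column≤n (w i) = subst (_≤ n) (toℕ-twin {n} i) (column≤n (r (twin i)))

  row : Vertex n → Fin 2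
  row (r _) = zero
  row (w _) = suc zero

  row-column-injective : ∀ u v → row u ≡ row v → column u ≡ column v → u ≡ v
  row-column-injective (r i) (r j) _ q = cong r (toℕ-injective q)
  row-column-injective (w i) (w j) _ q = cong (w {n}) (toℕ-injective (suc-injective q))

  Meets : Pred (Vertex n) 0ℓ → Pred ℕ 0ℓ
  Meets X k = ∃[ v ] v ∈ X × column v ≡ k

  -- Agility

  colour : (Fin (suc n) → Bool) → Vertex n → Bool
  colour c (r i) = c i
  colour c (w i) = not (c (twin {n} i))

  Class : (Fin (suc n) → Bool) → Bool → Pred (Vertex n) 0ℓ
  Class c a v = colour c v ≡ a

  module _ (c : Fin (suc n) → Bool) (a : Bool) where

    -- Two distinct vertices of one column are an `r` and its partner `w`, to which `colour` gives
    -- opposite values.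
    class-column-injective : ∀ u v → u ∈ Class c a → v ∈ Class c a →
      column u ≡ column v → u ≡ v
    class-column-injective (r i) (r j) _ _ q = row-column-injective _ _ refl q
    class-column-injective (w i) (w j) _ _ q = row-column-injective (w i) (w j) refl q
    class-column-injective (r i) (w j) p p′ q
      with refl ← toℕ-injective {i = i} {twin {n} j} (trans q (sym (toℕ-twin {n} j)))
      = contradiction (trans p (sym p′)) (not-¬ refl)
    class-column-injective (w i) (r j) p p′ q
      = sym (class-column-injective (r j) (w i) p′ p (sym q))

    class-meets-windex : ∀ i → Meets (Class c a) (windex {n} i)
    class-meets-windex i with c (twin i) ≟ᵇ a
    ... | yes p = r (twin i) , p , toℕ-twin {n} i
    ... | no ¬p = w i , sym (¬-not (¬p ∘ sym)) , refl

    class-meets-inner : ∀ {k} → suc k < n → Meets (Class c a) (suc k)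
    class-meets-inner 1+k<n =
      subst (Meets (Class c a)) (cong suc (toℕ-fromℕ< k<n∸1))
        (class-meets-windex (fromℕ< k<n∸1))
      where k<n∸1 = ∸-monoˡ-≤ 1 1+k<n

    -- A column strictly between those of `u` and `v` is inner; if there is none, `v` itself lies in
    -- the next column.
    class-meets-next : ∀ {u v} → v ∈ Class c a → column u < column v →
      Meets (Class c a) (suc (column u))
    class-meets-next {v = v} pv u<v with m≤n⇒m<n∨m≡n u<v
    ... | inj₁ 1+u<v = class-meets-inner (<-≤-trans 1+u<v (column≤n v))
    ... | inj₂ 1+u≡v = v , pv , sym 1+u≡v

    private
      H = induced G (Class c a)

    class-path : ∀ d {u v} → u ∈ Class c a → v ∈ Class c a →
      d + column u ≡ column v → Star (edges H) u v
    class-path zero {u} {v} pu pv q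
      with refl ← class-column-injective u v pu pv q = ε
    class-path (suc d) {u} {v} pu pv q
      with x , px , eq ← class-meets-next {u} {v} pv
             (≤-trans (s≤s (m≤n+m (column u) d)) (≤-reflexive q))
      = (pu , px , next⇒adj u x eq) ◅
        class-path d px pv
          (trans (cong (d +_) eq) (trans (+-suc d (column u)) q))

    class-connected : ∀ {u v} → u ∈ Class c a → v ∈ Class c a →
      Star (edges H) u v
    class-connected {u} {v} pu pv with ≤-total (column u) (column v)
    ... | inj₁ u≤v = class-path _ pu pv (m∸n+n≡m u≤v)
    ... | inj₂ v≤u = reverse (edges-sym H) (class-path _ pv pu (m∸n+n≡m v≤u))

    -- The path from x through y moves in direction Step, so it cannot get back to
    -- z, which lies behind x.  Step is Next or its converse.
    module _ {_≺_ : Rel ℕ 0ℓ} (≺-trans : Transitive _≺_)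
             (≺-irrefl : ∀ {i} → ¬ i ≺ i)
             {Step : Rel ℕ 0ℓ} (step⇒≺ : ∀ {i j} → Step i j → i ≺ j)
             (step-injective : ∀ {i j k} → Step i k → Step j k → i ≡ j)
             (step-total : ∀ {i j} → Consecutive i j → Step i j ⊎ Step j i)
             where

      -- An edge going back from `y` would end in the column of `x`, whose only class vertex is `x`.
      edge-forward : ∀ {x y y′} → x ∈ Class c a → Step (column x) (column y) →
        x ≢ y′ → edges H y y′ → Step (column y) (column y′)
      edge-forward {x} {y} {y′} px xy x≢y′ (_ , py′ , e)
        with step-total (adj⇒consecutive e)
      ... | inj₁ yy′ = yy′
      ... | inj₂ y′y = contradiction
        (class-column-injective x y′ px py′ (step-injective xy y′y)) x≢y′

      no-return : ∀ {x y z} ys → column z ≺ column x → x ∈ Class c a →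
        Step (column x) (column y) → Unique (x ∷ y ∷ ys) →
        ¬ Linked (edges H) (y ∷ ys ∷ʳ z)
      no-return {x} {y} {z} [] z≺x px xy _ (yz ∷ _) =
        ≺-irrefl (≺-trans z≺y (step⇒≺ (edge-forward px xy x≢z yz)))
        where
        z≺y = ≺-trans z≺x (step⇒≺ xy)
        x≢z : x ≢ z
        x≢z refl = ≺-irrefl z≺x
      no-return (y′ ∷ ys) z≺x px xy ((_ ∷ x≢y′ ∷ _) ∷ unique) (yy′ ∷ linked) =
        no-return ys (≺-trans z≺x (step⇒≺ xy)) (proj₁ yy′)
          (edge-forward px xy x≢y′ yy′) unique linked

      no-cycle : ∀ {x y z zs} → Step (column x) (column y) →
        Unique (x ∷ y ∷ z ∷ zs) → ¬ Linked (edges H) (x ∷ y ∷ z ∷ zs ∷ʳ x)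
      no-cycle xy ((_ ∷ x≢z ∷ _) ∷ unique) (e ∷ f ∷ linked) =
        -- The walk is started at `y`, so that `x`, the target of the closing edge, lies behind it.
        no-return _ (step⇒≺ xy) (proj₁ f)
          (edge-forward (proj₁ e) xy x≢z f) unique linked

    class-acyclic : Acyclic H
    class-acyclic x (y ∷ []) (s≤s () , _)
    class-acyclic x (y ∷ z ∷ zs) (_ , unique , linked@((_ , _ , e) ∷ _))
      with adj⇒consecutive e
    ... | fwd xy = no-cycle <-trans (<-irrefl refl) {Next} (≤-reflexive ∘ sym)
      (λ { refl refl → refl }) (λ { (fwd p) → inj₁ p ; (bwd p) → inj₂ p })
      xy unique linked
    ... | bwd yx = no-cycle (flip <-trans) (<-irrefl refl) {flip Next}
      (≤-reflexive ∘ sym)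
      (λ p q → trans p (sym q))
      (λ { (fwd p) → inj₂ p ; (bwd p) → inj₁ p })
      yx unique linked

    class-covering : ∀ {X : Pred (Vertex n) 0ℓ} → X ⊆ IsR → X ⊆ Class c a →
      Σ[ T ∈ Subgraph G ] verts T ⊆ Class c a × TreeCovering X T
    class-covering {X} X⊆R X⊆c with any? (λ i → c i ≟ᵇ a)
    ... | yes (i , ci≡a) = H , (λ p → p) ,
      X⊆c , inj₁ (((r i , ci≡a) , class-connected) , class-acyclic)
    -- A class without any `r` may be empty and then is no tree; but `X` is empty too, so the empty
    -- subgraph serves.
    ... | no unused = induced G ∅ , (λ ()) ,
      (λ {v} p → X-empty v p) , inj₂ (X-empty , λ _ ())
      where
      X-empty : ∀ v → ¬ (v ∈ X)
      X-empty v p with isR i ← X⊆R p = unused (i , X⊆c p)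

  isR-agile : Agile G IsR
  isR-agile X₁ X₂ (⊆R , R⊆) disjoint =
    let T₁ , T₁⊆ , cover₁ = class-covering c true (⊆R ∘ inj₁) X₁⊆
        T₂ , T₂⊆ , cover₂ = class-covering c false (⊆R ∘ inj₂) X₂⊆
    in T₁ , T₂ , (λ (p₁ , p₂) → bool (trans (sym (T₁⊆ p₁)) (T₂⊆ p₂))) ,
         cover₁ , cover₂
    where
    c : Fin (suc n) → Bool
    -- Membership in the union carries a choice of side, so `c` is computed even for undecidable
    -- `X₁` and `X₂`.
    c i = [ const true , const false ]′ (R⊆ (isR i))

    bool : true ≢ false
    bool ()

    X₁⊆ : X₁ ⊆ Class c true
    X₁⊆ p with isR i ← ⊆R (inj₁ p) with R⊆ (isR i)
    ... | inj₁ _ = refl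
    ... | inj₂ q = contradiction (p , q) disjoint

    X₂⊆ : X₂ ⊆ Class c false
    X₂⊆ p with isR i ← ⊆R (inj₂ p) with R⊆ (isR i)
    ... | inj₁ q = contradiction (q , p) disjoint
    ... | inj₂ _ = refl

  -- Minors

  -- An edge raises the column by at most one, so a path from column `i` to column `j` cannot skip
  -- `k`.
  connected⇒convex : ∀ {X} → Connected (induced G X) → ∀ {i j k} →
    Meets X i → Meets X j → i ≤ k → k ≤ j → Meets X k
  connected⇒convex {X} (_ , path) (u , pu , refl) (v , pv , refl) =
    along (path pu pv) pu
    where
    along : ∀ {u v k} → Star (edges (induced G X)) u v → u ∈ X →
      column u ≤ k → k ≤ column v → Meets X k
    along {u} ε pu u≤k k≤u = u , pu , ≤-antisym u≤k k≤u
    along {u} {v} (_◅_ {j = u′} (_ , pu′ , e) es) pu u≤k k≤v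
      with m≤n⇒m<n∨m≡n u≤k
    ... | inj₁ u<k = along es pu′
                       (≤-trans (consecutive⇒≤ (adj⇒consecutive e)) u<k) k≤v
    ... | inj₂ u≡k = u , pu , u≡k

  -- Hubs and leaves of a K_{2,5} minor.

  module _ (M : MinorModel (K 2 5) G) where

    open MinorModel M

    private
      Hit : V (K 2 5) → Pred ℕ 0ℓ
      Hit x = Meets (branch x)

      hub : Fin 2 → V (K 2 5)
      hub = inj₁

      leaf : Fin 5 → V (K 2 5)
      leaf = inj₂

    convex : ∀ x {i j k} → Hit x i → Hit x j → i ≤ k → k ≤ j → Hit x k
    convex x = connected⇒convex (branch-connected x)

    hits-some : ∀ x → ∃ (Hit x)
    hits-some x with (v , pv) , _ ← branch-connected x = column v , v , pv , refl

    touch : ∀ {x y} → Adj (K 2 5) x y →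
      ∃[ i ] ∃[ j ] Hit x i × Hit y j × Consecutive i j
    touch {x} {y} e with u , v , pu , pv , uv ← branch-adjacent {x} {y} e =
      column u , column v , (u , pu , refl) , (v , pv , refl) , adj⇒consecutive uv

    same-column⇒row≢ : ∀ {x y k l} → x ≢ y → k ≡ l →
      ((u , _) : Hit x k) ((v , _) : Hit y l) → row u ≢ row v
    same-column⇒row≢ x≢y k≡l (u , pu , u≡k) (v , pv , v≡l) eq
      with refl ← row-column-injective u v eq (trans u≡k (trans k≡l (sym v≡l)))
      = branch-disjoint x≢y (pu , pv)

    -- Pigeonhole: two columns with two rows give four slots, encoded by `combine`, for five
    -- disjoint leaves.
    leaves-overfull : ∀ {p q} → ¬ (∀ j → Hit (leaf j) p ⊎ Hit (leaf j) q)
    leaves-overfull {p} {q} hits =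
      let i , j , i<j , eq = pigeonhole (n<1+n 4) slot
          side≡ , row≡     = combine-injective (side i) _ (side j) _ eq
      in same-column⇒row≢ (<⇒≢ i<j ∘ inj₂-injective) (cong columns side≡)
           (place i) (place j) row≡
      where
      columns : Fin 2 → ℕ
      columns zero       = p
      columns (suc zero) = q

      placed : ∀ j → ∃[ d ] Hit (leaf j) (columns d)
      placed j = [ (λ h → zero , h) , (λ h → suc zero , h) ]′ (hits j)

      side : Fin 5 → Fin 2
      side j = proj₁ (placed j)

      place : ∀ j → Hit (leaf j) (columns (side j))
      place j = proj₂ (placed j)

      slot : Fin 5 → Fin 4
      slot j = combine (side j) (row (proj₁ (place j)))

    Common : Pred ℕ 0ℓ
    Common k = Hit (hub zero) k × Hit (hub (suc zero)) k

    -- Three distinct rows would be needed: with the leaf's row punched out of `Fin 2`, the rows of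
    -- both hubs fall into `Fin 1` and coincide.
    leaf-avoids-common : ∀ {j k} → Common k → ¬ Hit (leaf j) k
    leaf-avoids-common (a , b) c = a≢b (punchOut-injective c≢a c≢b (fin1 _ _))
      where
      fin1 : (i j : Fin 1) → i ≡ j
      fin1 zero zero = refl
      a≢b = same-column⇒row≢ (λ ()) refl a b
      c≢a = same-column⇒row≢ (λ ()) refl c a
      c≢b = same-column⇒row≢ (λ ()) refl c b

    -- If the contact on the side of `x` lies before `e`, then `y` starts no later than `e` and
    -- reaches `s`, so convexity applies.
    touch-above : ∀ {x y e s} → Adj (K 2 5) x y → (∀ {c} → Hit x c → c ≤ e) →
      Hit y s → e ≤ s → Hit x e ⊎ Hit y e
    touch-above {x} {y} xy x≤e ys e≤s
      with c , a , xc , ya , ca ← touch {x} {y} xy with m≤n⇒m<n∨m≡n (x≤e xc)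
    ... | inj₁ c<e  = inj₂ (convex y ya ys (≤-trans (consecutive⇒≤ ca) c<e) e≤s)
    ... | inj₂ refl = inj₁ xc

    touch-below : ∀ {x y e s} → Adj (K 2 5) x y → (∀ {c} → Hit x c → e ≤ c) →
      Hit y s → s ≤ e → Hit x e ⊎ Hit y e
    touch-below {x} {y} xy x≥e ys s≤e
      with c , a , xc , ya , ca ← touch {x} {y} xy with m≤n⇒m<n∨m≡n (x≥e xc)
    ... | inj₁ e<c  = inj₂ (convex y ys ya s≤e
      (s≤s⁻¹ (≤-trans e<c (consecutive⇒≤ (symmetric Next ca)))))
    ... | inj₂ refl = inj₁ xc

    -- Hubs with a common column.

    no-common : ∀ {k} → ¬ Common k
    no-common common =
      least Common common λ (s , common-s , s≤) →
      -- Column `suc n` contains no vertex, so some column beyond `s` is not common.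
      least (λ k → s < k × ¬ Common k)
            (s≤s (column≤n′ common-s) , ¬common-1+n) λ (t , (s<t , ¬common-t) , t≤) →
      leaves-overfull (λ j → side common-s s≤ s<t ¬common-t t≤ j (hits-some (leaf j)))
      where
      column≤n′ : ∀ {s} → Common s → s ≤ n
      column≤n′ ((v , _ , refl) , _) = column≤n v

      ¬common-1+n : ¬ Common (suc n)
      ¬common-1+n c = ≤⇒≯ (column≤n′ c) ≤-refl

      module _ {s} (common-s : Common s) (s≤ : ∀ {k} → Common k → s ≤ k)
        {t} (s<t : s < t) (¬common-t : ¬ Common t)
        (t≤ : ∀ {k} → s < k × ¬ Common k → t ≤ k) (j : Fin 5) where

        -- A leaf in a column `k` beyond `s` would make `k` non-common, and minimality of `t` gives
        -- `t ≤ k`.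
        gap : ∀ {k} → s ≤ k → k < t → ¬ Hit (leaf j) k
        gap s≤k k<t h with m≤n⇒m<n∨m≡n s≤k
        ... | inj₁ s<k  = ≤⇒≯ (t≤ (s<k , λ c → leaf-avoids-common c h)) k<t
        ... | inj₂ refl = leaf-avoids-common common-s h

        -- If both hubs met column `p`, it would be a common column before `s`.
        below : ∀ {p} → p < s → (∀ {c} → Hit (leaf j) c → c ≤ p) → Hit (leaf j) p
        below p<s leaf≤p
          with touch-above {leaf j} {hub zero} tt leaf≤p (proj₁ common-s) (<⇒≤ p<s)
             | touch-above {leaf j} {hub (suc zero)} tt leaf≤p
                 (proj₂ common-s) (<⇒≤ p<s)
        ... | inj₁ h | _      = h
        ... | inj₂ _ | inj₁ h = h
        ... | inj₂ a | inj₂ b = contradiction p<s (≤⇒≯ (s≤ (a , b)))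

        above : (∀ {c} → Hit (leaf j) c → t ≤ c) → Hit (leaf j) t
        above leaf≥t
          with touch-below {leaf j} {hub zero} tt leaf≥t (proj₁ common-s) (<⇒≤ s<t)
             | touch-below {leaf j} {hub (suc zero)} tt leaf≥t
                 (proj₂ common-s) (<⇒≤ s<t)
        ... | inj₁ h | _      = h
        ... | inj₂ _ | inj₁ h = h
        ... | inj₂ a | inj₂ b = contradiction (a , b) ¬common-t

        side : ∃ (Hit (leaf j)) → Hit (leaf j) (pred s) ⊎ Hit (leaf j) t
        side (c , h) with ≤-<-connex s c
        -- As `c < s`, `s` is positive here and `pred s` is truly the preceding column.
        ... | inj₂ c<s = inj₁ (below (m<n⇒pred[n]<n c<s) λ h′ → <⇒≤pred (≰⇒> λ s≤c′ →
          gap ≤-refl s<t (convex (leaf j) h h′ (<⇒≤ c<s) s≤c′)))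
        -- If `c′ < t`, then also `c < t`, since otherwise the leaf would cross column `pred t`
        -- inside the gap.
        ... | inj₁ s≤c = inj₂ (above λ h′ → ≮⇒≥ λ c′<t →
          gap s≤c (≰⇒> λ t≤c → gap (<⇒≤pred s<t) (m<n⇒pred[n]<n s<t)
            (convex (leaf j) h′ h (<⇒≤pred c′<t) (≤-trans pred[n]≤n t≤c))) h)

    -- Hubs without a common column.

    no-separated-hubs : ∀ {h h′ a b} → a < b → Hit (hub h) a → Hit (hub h′) b →
      ¬ (∀ {k} → Hit (hub h) k → ¬ Hit (hub h′) k)
    no-separated-hubs {h} {h′} {a} {b} a<b ha hb disjoint =
      least (λ k → a < k × Hit (hub h′) k) (a<b , hb) finish
      where
      finish : ¬ (∃[ t ] (a < t × Hit (hub h′) t) ×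
                    (∀ {j} → a < j × Hit (hub h′) j → t ≤ j))
      finish (suc p , (s≤s a≤p , ht) , t≤) = leaves-overfull side
        where
        -- Reaching beyond `p`, hub `h` would by convexity enter column `suc p`, which `h′` meets.
        hub≤p : ∀ {m} → Hit (hub h) m → m ≤ p
        hub≤p {m} hm = ≮⇒≥ λ p<m →
          disjoint (convex (hub h) ha hm (≤-trans a≤p (n≤1+n p)) p<m) ht

        hub>p : ∀ {m} → Hit (hub h′) m → p < m
        hub>p {m} hm with ≤-<-connex m a
        ... | inj₁ m≤a = contradiction
          (convex (hub h′) hm hb m≤a (<⇒≤ a<b)) (disjoint ha)
        ... | inj₂ a<m = t≤ (a<m , hm)

        -- The leaf touches `h` from a column at most `suc p` and `h′` from a column at least `p`.
        side : ∀ j → Hit (leaf j) p ⊎ Hit (leaf j) (suc p)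
        side j
          with a′ , c , hub-a′ , leaf-c , a′c ← touch {hub h} {leaf j} tt
             | b′ , c′ , hub-b′ , leaf-c′ , b′c′ ← touch {hub h′} {leaf j} tt
          with m≤n⇒m<n∨m≡n (≤-trans (consecutive⇒≤ a′c) (s≤s (hub≤p hub-a′)))
        ... | inj₁ c<1+p = inj₁ (convex (leaf j) leaf-c leaf-c′ (s≤s⁻¹ c<1+p)
          (s≤s⁻¹ (≤-trans (hub>p hub-b′) (consecutive⇒≤ (symmetric Next b′c′)))))
        ... | inj₂ refl  = inj₂ leaf-c

  no-K₂,₅-minor : ¬ (K 2 5 IsMinorOf G)
  no-K₂,₅-minor M
    with a , ha ← hits-some M (inj₁ zero)
       | b , hb ← hits-some M (inj₁ (suc zero))
    with <-cmp a b
  ... | tri< a<b _ _  = no-separated-hubs M a<b ha hb λ h h′ → no-common M (h , h′)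
  ... | tri≈ _ refl _ = no-common M (ha , hb)
  ... | tri> _ _ b<a  = no-separated-hubs M b<a hb ha λ h h′ → no-common M (h′ , h)

mainTheorem4 : (n : ℕ) →
    Agile (theGraph n) IsR × ¬ (K 2 5 IsMinorOf theGraph n)
mainTheorem4 n = isR-agile , no-K₂,₅-minor
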